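{- Let $k,n$ be integers with $k\geq 3$ and $n\geq 2$, and let $c$ be an exact $k$-coloring of $\mathcal{B}_n$. Then $\mathcal{B}_n$ contains no rainbow induced copy of $\vee_2$ if and only if one of the following holds: (1) There exists a set $A\subseteq[n]$ with $|A|\leq n-2$ such that each of the three families $\mathcal{B}_{(A,[n])}$, $\mathcal{B}_n\setminus\mathcal{B}_{[A,[n]]}$, and $\{A\}$ is monochromatic, and no two sets from different ones of these families share a color; moreover, if $k=3$ the color of $[n]$ is unrestricted, and if $k=4$ then $[n]$ receives a color different from all colors used on $\mathcal{B}_{[\emptyset,[n])}$. (2) Exactly two colors appear on $\mathcal{B}_{[\emptyset,[n])}$, and $[n]$ receives a color distinct from these two.
   Context: $\mathcal{B}_n$ denotes the Boolean lattice of all subsets of $[n]$ ordered by inclusion. For $X\subseteq Y$: $\mathcal{B}_{[X,Y]}=\{Z: X\subseteq Z\subseteq Y\}$, $\mathcal{B}_{(X,Y]}=\{Z:X\subsetneq Z\subseteq Y\}$, $\mathcal{B}_{[X,Y)}=\{Z:X\subseteq Z\subsetneq Y\}$, $\mathcal{B}_{(X,Y)}=\{Z:X\subsetneq Z\subsetneq Y\}$. An exact $k$-coloring is a surjective map $\mathcal{B}_n\to[k]$. $\vee_2$ is the poset $\{X_0,X_1,X_2\}$ with $X_0<X_1$, $X_0<X_2$, $X_1,X_2$ incomparable; a rainbow induced copy of $\vee_2$ is three sets $X_0\subsetneq X_1$, $X_0\subsetneq X_2$ with $X_1,X_2$ incomparable and pairwise distinct colors. -}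

module Defs where

open import Data.Nat using (ℕ; _≤_; _∸_)
open import Data.Fin using (Fin)
open import Data.Fin.Subset using (Subset; _⊆_; _⊂_; _⊈_; ⊤; ⊥; ∣_∣)
open import Data.Product using (∃; ∃₂; _×_)
open import Data.Sum using (_⊎_)
open import Function.Bundles using (_⇔_)
open import Function.Definitions using (Surjective)
open import Level using (0ℓ)
open import Relation.Binary.PropositionalEquality using (_≡_; _≢_)
open import Relation.Unary using (Pred; ∁; ｛_｝)

-- The Boolean lattice of subsets of [n] is `Subset n` ordered by `_⊆_`;
-- its least and greatest elements ∅ and [n] are `⊥` and `⊤`.

Coloring : ℕ → ℕ → Set
Coloring n k = Subset n → Fin k

Exact : ∀ {n k} → Coloring n k → Set
Exact c = Surjective _≡_ _≡_ c

Family : ℕ → Set₁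
Family n = Pred (Subset n) 0ℓ

closed : ∀ {n} → Subset n → Subset n → Family n
closed X Y Z = X ⊆ Z × Z ⊆ Y

rightOpen : ∀ {n} → Subset n → Subset n → Family n
rightOpen X Y Z = X ⊆ Z × Z ⊂ Y

open′ : ∀ {n} → Subset n → Subset n → Family n
open′ X Y Z = X ⊂ Z × Z ⊂ Y

record RainbowInduced∨₂ {n k} (c : Coloring n k) : Set where
  field
    X₀ X₁ X₂ : Subset n
    X₀⊂X₁    : X₀ ⊂ X₁
    X₀⊂X₂    : X₀ ⊂ X₂
    X₁⊈X₂    : X₁ ⊈ X₂
    X₂⊈X₁    : X₂ ⊈ X₁
    c₀≢c₁    : c X₀ ≢ c X₁
    c₀≢c₂    : c X₀ ≢ c X₂
    c₁≢c₂    : c X₁ ≢ c X₂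

-- An empty family counts as monochromatic.
Monochromatic : ∀ {n k} → Coloring n k → Family n → Set
Monochromatic c F = ∀ {Y Z} → F Y → F Z → c Y ≡ c Z

NoSharedColor : ∀ {n k} → Coloring n k → Family n → Family n → Set
NoSharedColor c F G = ∀ {Y Z} → F Y → G Z → c Y ≢ c Z

AppearsOn : ∀ {n k} → Coloring n k → Family n → Fin k → Set
AppearsOn c F i = ∃ λ Z → F Z × c Z ≡ i

ExactlyTwoColorsOn : ∀ {n k} → Coloring n k → Family n → Set
ExactlyTwoColorsOn c F =
  ∃₂ λ i j → i ≢ j × (∀ x → AppearsOn c F x ⇔ (x ≡ i ⊎ x ≡ j))

NewColorAtTop : ∀ {n k} → Coloring n k → Set
NewColorAtTop c = NoSharedColor c ｛ ⊤ ｝ (rightOpen ⊥ ⊤)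

-- There is no field for k ≡ 3, since the color of [n] is then unrestricted.
record Pivot {n k} (c : Coloring n k) (A : Subset n) : Set where
  field
    size        : ∣ A ∣ ≤ n ∸ 2
    above-mono  : Monochromatic c (open′ A ⊤)
    other-mono  : Monochromatic c (∁ (closed A ⊤))
    pivot-mono  : Monochromatic c ｛ A ｝
    above≢other : NoSharedColor c (open′ A ⊤) (∁ (closed A ⊤))
    above≢pivot : NoSharedColor c (open′ A ⊤) ｛ A ｝
    other≢pivot : NoSharedColor c (∁ (closed A ⊤)) ｛ A ｝
    top         : k ≡ 4 → NewColorAtTop c

PivotColoring : ∀ {n k} → Coloring n k → Set
PivotColoring c = ∃ λ A → Pivot c A

TwoColorsBelowTop : ∀ {n k} → Coloring n k → Set
TwoColorsBelowTop c = ExactlyTwoColorsOn c (rightOpen ⊥ ⊤) × NewColorAtTop c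

{-# OPTIONS --safe #-}

-- Every induced ∨₂ with bottom ∅ is non-rainbow, so two sets whose colors
-- differ from c ∅ and from each other are comparable.  Suppose A ⊂ Y ⊂ [n] are
-- two such sets.  A proper Z ⊃ A incomparable to Y has a color in {c A , c Y}
-- (look from A) and in {c ∅ , c Y} (look from ∅), hence the color of Y; as the
-- incomparability graph of the open interval (A , [n]) is connected, that
-- interval has the single color c Y.  A set Z ⊉ A not below A is incomparable
-- to A and to [n] ∖ z for z ∈ Z ∖ A, whence c Z = c ∅; a set Z ⊂ A of
-- another color would itself force A and Y to agree in color.  So A is a pivot.
-- If there is no such pair, only two colors occur below [n].
module Submission where

open import Defs
open import Data.Nat using (ℕ; _≤_; _<_; s≤s)
open import Data.Nat.Properties using (<⇒≱; ≤-trans; ∸-monoˡ-≤; ≤-reflexive)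
open import Data.Empty using () renaming (⊥ to Empty)
open import Data.Fin using (Fin; _≟_)
open import Data.Fin.Properties using (¬∀⟶∃¬; injective⇒≤)
open import Data.Fin.Subset
  using (Subset; _∈_; _∉_; _⊆_; _⊂_; _⊈_; ⊤; ⊥; _∪_; ⁅_⁆)
  renaming (∁ to complement)
open import Data.Fin.Subset.Properties
  using ( _∈?_; _⊆?_; _⊂?_; anySubset?; ∈⊤; ⊆⊤; ⊥⊆; ∉⊥; ∣⊤∣≡n
        ; ⊆-antisym; ⊂-⊆-trans; ⊂-trans; ⊆-⊂-trans; p⊂q⇒p⊆q; p⊂q⇒∣p∣<∣q∣
        ; x∈⁅x⁆; x∈⁅y⁆⇒x≡y; x≢y⇒x∉⁅y⁆; x∈p⇒x∉∁p; x∉p⇒x∈∁p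
        ; p⊆p∪q; x∈p∪q⁺; x∈p∪q⁻)
open import Data.Product using (∃; _×_; _,_; proj₁; proj₂)
open import Data.Sum using (_⊎_; inj₁; inj₂; [_,_]′)
open import Data.Vec using (Vec; []; _∷_; lookup)
open import Data.Vec.Membership.DecPropositional using () renaming (_∈?_ to memberOf?)
open import Data.Vec.Membership.Propositional
  using () renaming (_∈_ to _∈ᵛ_; _∉_ to _∉ᵛ_)
open import Data.Vec.Relation.Unary.Any using (here; there; index)
open import Data.Vec.Relation.Unary.Any.Properties using (lookup-index)
open import Function using (_∘_)
open import Function.Bundles using (_⇔_; mk⇔; Equivalence)
open import Relation.Binary.PropositionalEquality
  using (_≡_; _≢_; refl; sym; trans; cong; subst; ≢-sym)
open import Relation.Nullary using (¬_; Dec; yes; no; contradiction)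
open import Relation.Nullary.Decidable using (decidable-stable; ¬?; _→-dec_; _×-dec_)
open import Relation.Unary using (∁)

-- Spare colors and incomparable sets.

private
  variable
    n k m : ℕ
    X Y Z U A : Subset n

-- Pigeonhole: if every color were listed, sending a color to its index in `xs` would inject `Fin k`
-- into `Fin m`.
fresh : m < k → (xs : Vec (Fin k) m) → ∃ λ i → i ∉ᵛ xs
fresh m<k xs = ¬∀⟶∃¬ _ (_∈ᵛ xs) (λ i → memberOf? _≟_ i xs) λ all∈ →
  <⇒≱ m<k (injective⇒≤ {f = index ∘ all∈} λ {i} {j} eq →
    trans (lookup-index (all∈ i))
      (trans (cong (lookup xs) eq) (sym (lookup-index (all∈ j)))))

⊈⇒∃∉ : X ⊈ Y → ∃ λ x → x ∈ X × x ∉ Y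
⊈⇒∃∉ {X = X} {Y = Y} X⊈Y
  with x , ¬imp ← ¬∀⟶∃¬ _ (λ x → x ∈ X → x ∈ Y)
                    (λ x → (x ∈? X) →-dec (x ∈? Y)) (λ f → X⊈Y (f _))
  = x , decidable-stable (x ∈? X) (λ x∉X → ¬imp λ x∈X → contradiction x∈X x∉X)
      , λ x∈Y → ¬imp λ _ → x∈Y

⊆∧⊉⇒⊂ : X ⊆ Y → Y ⊈ X → X ⊂ Y
⊆∧⊉⇒⊂ X⊆Y Y⊈X = X⊆Y , ⊈⇒∃∉ Y⊈X

⊈⇒⊂⊤ : X ⊈ Y → Y ⊂ ⊤
⊈⇒⊂⊤ X⊈Y with x , _ , x∉Y ← ⊈⇒∃∉ X⊈Y = ⊆⊤ , x , ∈⊤ , x∉Y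

⊂⇒⊉ : X ⊂ Y → Y ⊈ X
⊂⇒⊉ (_ , x , x∈Y , x∉X) Y⊆X = x∉X (Y⊆X x∈Y)

⊈⇒⊥⊂ : X ⊈ Y → ⊥ ⊂ X
⊈⇒⊥⊂ X⊈Y with x , x∈X , _ ← ⊈⇒∃∉ X⊈Y = ⊥⊆ , x , x∈X , ∉⊥

-- U serves as a common upper bound of two comparable sets Y: one added
-- element then works for both.
∪-outside-incomparable : ∀ {w} → A ⊂ Y → Y ⊆ U → w ∉ U →
  (Y ⊈ (A ∪ ⁅ w ⁆)) × ((A ∪ ⁅ w ⁆) ⊈ Y)
∪-outside-incomparable {A = A} {w = w} (_ , y , y∈Y , y∉A) Y⊆U w∉U
  = (λ Y⊆W → [ y∉A , (λ y∈w → w∉U (subst (_∈ _) (x∈⁅y⁆⇒x≡y w y∈w) (Y⊆U y∈Y))) ]′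
               (x∈p∪q⁻ A ⁅ w ⁆ (Y⊆W y∈Y)))
  , λ W⊆Y → w∉U (Y⊆U (W⊆Y (x∈p∪q⁺ (inj₂ (x∈⁅x⁆ w)))))

preimage-below-⊤ : (c : Coloring n k) → Exact c → ∀ {i} → i ≢ c ⊤ →
  ∃ λ X → X ⊂ ⊤ × c X ≡ i
preimage-below-⊤ c exact {i} i≢c⊤ with X , cX≡i ← exact i =
  X , ⊆∧⊉⇒⊂ ⊆⊤ (λ ⊤⊆X → i≢c⊤ (trans (sym (cX≡i refl)) (cong c (⊆-antisym ⊆⊤ ⊤⊆X))))
    , cX≡i refl

-- By exactness a color missing from `xs` is attained, and only `⊤` can attain it; a proper subset
-- sharing that color would put it in `xs`.
few-below⇒newColorAtTop : (c : Coloring n k) → Exact c → m < k →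
  (xs : Vec (Fin k) m) → (∀ {Z} → Z ⊂ ⊤ → c Z ∈ᵛ xs) → NewColorAtTop c
few-below⇒newColorAtTop c exact m<k xs below refl (_ , Z⊂⊤) c⊤≡cZ
  with i , i∉xs ← fresh m<k xs
  with i ≟ c ⊤
... | yes i≡c⊤ = i∉xs (subst (_∈ᵛ xs) (trans (sym c⊤≡cZ) (sym i≡c⊤)) (below Z⊂⊤))
... | no  i≢c⊤ with X , X⊂⊤ , refl ← preimage-below-⊤ c exact i≢c⊤ = i∉xs (below X⊂⊤)

-- Structure of rainbow-free colorings.

record ThreeColorChain {n k} (c : Coloring n k) (A Y : Subset n) : Set where
  constructor chain
  field
    A⊂Y : A ⊂ Y
    Y⊂⊤ : Y ⊂ ⊤
    -- This makes `A` nonempty, so `⊥` is a third, strictly lower member of the chain.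
    ⊥≢A : c ⊥ ≢ c A
    ⊥≢Y : c ⊥ ≢ c Y
    A≢Y : c A ≢ c Y

module RainbowFree {c : Coloring n k} (free : ¬ RainbowInduced∨₂ c) where

  avoid : ∀ {X₀ X₁ X₂} → X₀ ⊂ X₁ → X₀ ⊂ X₂ → X₁ ⊈ X₂ → X₂ ⊈ X₁ →
    c X₀ ≢ c X₁ → c X₀ ≢ c X₂ → c X₁ ≡ c X₂
  avoid X₀⊂X₁ X₀⊂X₂ X₁⊈X₂ X₂⊈X₁ c₀≢c₁ c₀≢c₂ = decidable-stable (_ ≟ _) λ c₁≢c₂ →
    free record
      { X₀⊂X₁ = X₀⊂X₁ ; X₀⊂X₂ = X₀⊂X₂ ; X₁⊈X₂ = X₁⊈X₂ ; X₂⊈X₁ = X₂⊈X₁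
      ; c₀≢c₁ = c₀≢c₁ ; c₀≢c₂ = c₀≢c₂ ; c₁≢c₂ = c₁≢c₂ }

  avoid-⊥ : X ⊈ Y → Y ⊈ X → c ⊥ ≢ c X → c ⊥ ≢ c Y → c X ≡ c Y
  avoid-⊥ X⊈Y Y⊈X = avoid (⊈⇒⊥⊂ X⊈Y) (⊈⇒⊥⊂ Y⊈X) X⊈Y Y⊈X

  above-incomparable : c ⊥ ≢ c A → c ⊥ ≢ c Y → c A ≢ c Y → A ⊂ Y → A ⊂ Z →
    Y ⊈ Z → Z ⊈ Y → c Z ≡ c Y
  above-incomparable {A = A} {Z = Z} ⊥≢A ⊥≢Y A≢Y A⊂Y A⊂Z Y⊈Z Z⊈Y with c A ≟ c Z
  ... | yes A≡Z = sym (avoid-⊥ Y⊈Z Z⊈Y ⊥≢Y λ ⊥≡Z → ⊥≢A (trans ⊥≡Z (sym A≡Z)))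
  ... | no  A≢Z = sym (avoid A⊂Y A⊂Z Y⊈Z Z⊈Y A≢Y A≢Z)

  module _ {A Y : Subset n} (ch : ThreeColorChain c A Y) where
    open ThreeColorChain ch

    -- A two-step path of incomparabilities: `A ∪ ⁅ w ⁆` is incomparable to both `Y` and `Z`, so it
    -- takes the color of `Y` and then replaces `Y` in comparing with `Z`.
    above-bounded : A ⊂ Z → Y ⊆ U → Z ⊆ U → U ⊂ ⊤ → c Z ≡ c Y
    above-bounded {Z = Z} A⊂Z Y⊆U Z⊆U (_ , w , _ , w∉U)
      with Y⊈W , W⊈Y ← ∪-outside-incomparable A⊂Y Y⊆U w∉U
         | Z⊈W , W⊈Z ← ∪-outside-incomparable A⊂Z Z⊆U w∉U =
      trans (above-incomparable ⊥≢A (⊥≢Y ∘ λ e → trans e W≡Y) (A≢Y ∘ λ e → trans e W≡Y)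
              A⊂W A⊂Z W⊈Z Z⊈W)
            W≡Y
      where
      A⊂W : A ⊂ (A ∪ ⁅ w ⁆)
      A⊂W = ⊆∧⊉⇒⊂ (p⊆p∪q ⁅ w ⁆) λ W⊆A → W⊈Y (λ x∈W → p⊂q⇒p⊆q A⊂Y (W⊆A x∈W))

      W≡Y : c (A ∪ ⁅ w ⁆) ≡ c Y
      W≡Y = above-incomparable ⊥≢A ⊥≢Y A≢Y A⊂Y A⊂W Y⊈W W⊈Y

    above : A ⊂ Z → Z ⊂ ⊤ → c Z ≡ c Y
    above {Z = Z} A⊂Z Z⊂⊤ with Y ⊆? Z | Z ⊆? Y
    ... | yes Y⊆Z | _       = above-bounded A⊂Z Y⊆Z (λ x∈Z → x∈Z) Z⊂⊤
    ... | no _    | yes Z⊆Y = above-bounded A⊂Z (λ x∈Y → x∈Y) Z⊆Y Y⊂⊤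
    ... | no Y⊈Z  | no Z⊈Y  = above-incomparable ⊥≢A ⊥≢Y A≢Y A⊂Y A⊂Z Y⊈Z Z⊈Y

    incomparable-other : A ⊈ Z → Z ⊈ A → c Z ≡ c ⊥
    incomparable-other {Z = Z} A⊈Z Z⊈A = decidable-stable (_ ≟ _) λ Z≢⊥ →
      let ⊥≢Z = ≢-sym Z≢⊥ in
      A≢Y (trans (avoid-⊥ A⊈Z Z⊈A ⊥≢A ⊥≢Z)
             (trans (sym (avoid-⊥ C⊈Z Z⊈C (⊥≢Y ∘ λ e → trans e C≡Y) ⊥≢Z)) C≡Y))
      where
      z = proj₁ (⊈⇒∃∉ Z⊈A)
      z∈Z = proj₁ (proj₂ (⊈⇒∃∉ Z⊈A))
      z∉A = proj₂ (proj₂ (⊈⇒∃∉ Z⊈A))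

      -- The largest set that omits `z`: it contains `A` but not `Z`, and `above` gives it the color
      -- of `Y`.
      C = complement ⁅ z ⁆

      z∉C : z ∉ C
      z∉C = x∈p⇒x∉∁p (x∈⁅x⁆ z)

      ≢z⇒∈C : ∀ {x} → x ≢ z → x ∈ C
      ≢z⇒∈C = x∉p⇒x∈∁p ∘ x≢y⇒x∉⁅y⁆

      A⊆C : A ⊆ C
      A⊆C x∈A = ≢z⇒∈C λ { refl → z∉A x∈A }

      A⊂C : A ⊂ C
      A⊂C with _ , y , y∈Y , y∉A ← A⊂Y | _ , w , _ , w∉Y ← Y⊂⊤ | y ≟ z
      ... | no  y≢z  = A⊆C , y , ≢z⇒∈C y≢z , y∉A
      -- The element of `Y` outside `A` is the one `C` omits; a point outside `Y` witnesses
      -- strictness instead.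
      ... | yes refl = A⊆C , w , ≢z⇒∈C (λ { refl → w∉Y y∈Y }) , w∉Y ∘ p⊂q⇒p⊆q A⊂Y

      C⊈Z : C ⊈ Z
      C⊈Z C⊆Z = A⊈Z λ x∈A → C⊆Z (A⊆C x∈A)

      Z⊈C : Z ⊈ C
      Z⊈C Z⊆C = z∉C (Z⊆C z∈Z)

      C≡Y : c C ≡ c Y
      C≡Y = above A⊂C (⊈⇒⊂⊤ Z⊈C)

  module _ {A Y : Subset n} (ch : ThreeColorChain c A Y) where
    open ThreeColorChain ch

    -- Otherwise `Z` starts a chain itself, with `Y` or, if `c Z ≡ c Y`, with `A`; `above` for that
    -- chain gives `A` and `Y` one color. Using `above` on chains other than `ch` calls for a second
    -- module.
    below-other : Z ⊂ A → c Z ≡ c ⊥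
    below-other {Z = Z} Z⊂A = decidable-stable (_ ≟ _) λ Z≢⊥ → absurd (≢-sym Z≢⊥)
      where
      A⊂⊤ = ⊂-trans A⊂Y Y⊂⊤
      Z⊂Y = ⊂-trans Z⊂A A⊂Y

      absurd : ¬ (c ⊥ ≢ c Z)
      absurd ⊥≢Z with c Z ≟ c Y
      ... | no  Z≢Y = A≢Y (above (chain Z⊂Y Y⊂⊤ ⊥≢Z ⊥≢Y Z≢Y) Z⊂A A⊂⊤)
      ... | yes Z≡Y = A≢Y (sym (above (chain Z⊂A A⊂⊤ ⊥≢Z ⊥≢A λ Z≡A → A≢Y (trans (sym Z≡A) Z≡Y))
                                 Z⊂Y Y⊂⊤))

    other : A ⊈ Z → c Z ≡ c ⊥
    other {Z = Z} A⊈Z with Z ⊆? A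
    ... | yes Z⊆A = below-other (⊆∧⊉⇒⊂ Z⊆A A⊈Z)
    ... | no  Z⊈A = incomparable-other ch A⊈Z Z⊈A

    three-colors-below : Z ⊂ ⊤ → c Z ∈ᵛ (c ⊥ ∷ c A ∷ c Y ∷ [])
    three-colors-below {Z = Z} Z⊂⊤ with A ⊆? Z | Z ⊆? A
    ... | no A⊈Z  | _       = here (other A⊈Z)
    ... | yes A⊆Z | yes Z⊆A = there (here (cong c (⊆-antisym Z⊆A A⊆Z)))
    ... | yes A⊆Z | no Z⊈A  = there (there (here (above ch (⊆∧⊉⇒⊂ A⊆Z Z⊈A) Z⊂⊤)))

    pivot : Exact c → Pivot c A
    pivot exact = record
      -- Two strict inclusions below `⊤` give 2 + ∣ A ∣ ≤ n.
      { size        = ∸-monoˡ-≤ 2 (≤-trans (s≤s (p⊂q⇒∣p∣<∣q∣ A⊂Y))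
                        (≤-trans (p⊂q⇒∣p∣<∣q∣ Y⊂⊤) (≤-reflexive (∣⊤∣≡n n))))
      ; above-mono  = λ Z∈ Z′∈ → trans (above′ Z∈) (sym (above′ Z′∈))
      ; other-mono  = λ Z∈ Z′∈ → trans (other′ Z∈) (sym (other′ Z′∈))
      ; pivot-mono  = λ { refl refl → refl }
      ; above≢other = λ Z∈ Z′∈ eq → ⊥≢Y (trans (sym (other′ Z′∈)) (trans (sym eq) (above′ Z∈)))
      ; above≢pivot = λ { Z∈ refl eq → A≢Y (trans (sym eq) (above′ Z∈)) }
      ; other≢pivot = λ { Z∈ refl eq → ⊥≢A (trans (sym (other′ Z∈)) eq) }
      -- With `k` equal to 4, the three colors below `⊤` leave one to spare.
      ; top         = λ { refl → few-below⇒newColorAtTop c exact (≤-reflexive refl) _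
                                   three-colors-below }
      }
      where
      above′ : open′ A ⊤ Z → c Z ≡ c Y
      above′ (A⊂Z , Z⊂⊤) = above ch A⊂Z Z⊂⊤

      other′ : ∁ (closed A ⊤) Z → c Z ≡ c ⊥
      other′ Z∉ = other λ A⊆Z → Z∉ (A⊆Z , ⊆⊤)

  -- For a third color, comparability of `X` and `Z` would give a chain, and incomparability a
  -- rainbow copy rooted at `⊥`.
  two-colors-below : (∀ {A Y} → ¬ ThreeColorChain c A Y) → X ⊂ ⊤ → c ⊥ ≢ c X →
    Z ⊂ ⊤ → c Z ≡ c ⊥ ⊎ c Z ≡ c X
  two-colors-below {X = X} {Z = Z} none X⊂⊤ ⊥≢X Z⊂⊤ with c Z ≟ c ⊥ | c Z ≟ c X
  ... | yes Z≡⊥ | _       = inj₁ Z≡⊥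
  ... | no _    | yes Z≡X = inj₂ Z≡X
  ... | no Z≢⊥  | no Z≢X  with X ⊆? Z | Z ⊆? X
  ... | no X⊈Z  | no Z⊈X  = inj₂ (avoid-⊥ Z⊈X X⊈Z (≢-sym Z≢⊥) ⊥≢X)
  ... | yes X⊆Z | yes Z⊆X = inj₂ (cong c (⊆-antisym Z⊆X X⊆Z))
  ... | yes X⊆Z | no Z⊈X  = contradiction
    (chain (⊆∧⊉⇒⊂ X⊆Z Z⊈X) Z⊂⊤ ⊥≢X (≢-sym Z≢⊥) (≢-sym Z≢X)) none
  ... | no X⊈Z  | yes Z⊆X = contradiction
    (chain (⊆∧⊉⇒⊂ Z⊆X X⊈Z) X⊂⊤ (≢-sym Z≢⊥) ⊥≢X Z≢X) none

  twoColorsBelowTop : 3 ≤ k → Exact c → (∀ {A Y} → ¬ ThreeColorChain c A Y) → TwoColorsBelowTop c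
  twoColorsBelowTop 3≤k exact none
    -- Avoiding `c ⊤` puts a preimage below `⊤`; avoiding `c ⊥` makes its color the second one.
    with i , i∉ ← fresh 3≤k (c ⊥ ∷ c ⊤ ∷ [])
    with X , X⊂⊤ , refl ← preimage-below-⊤ c exact (i∉ ∘ there ∘ here)
    = (c ⊥ , c X , ⊥≢X , λ x → mk⇔
        (λ { (Z , (_ , Z⊂⊤) , refl) → two Z⊂⊤ })
        (λ { (inj₁ refl) → ⊥ , (⊥⊆ , ⊆-⊂-trans ⊥⊆ X⊂⊤) , refl
           ; (inj₂ refl) → X , (⊥⊆ , X⊂⊤) , refl }))
    , few-below⇒newColorAtTop c exact 3≤k (c ⊥ ∷ c X ∷ [])
        (λ Z⊂⊤ → [ here , there ∘ here ]′ (two Z⊂⊤))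
    where
    ⊥≢X : c ⊥ ≢ c X
    ⊥≢X = i∉ ∘ here ∘ sym

    two : Z ⊂ ⊤ → c Z ≡ c ⊥ ⊎ c Z ≡ c X
    two = two-colors-below none X⊂⊤ ⊥≢X

  structure : 3 ≤ k → Exact c → PivotColoring c ⊎ TwoColorsBelowTop c
  structure 3≤k exact
    -- Exhaustive search over pairs decides the dichotomy constructively.
    with anySubset? (λ A → anySubset? λ Y →
           (A ⊂? Y) ×-dec (Y ⊂? ⊤) ×-dec
           ¬? (c ⊥ ≟ c A) ×-dec ¬? (c ⊥ ≟ c Y) ×-dec ¬? (c A ≟ c Y))
  ... | yes (A , Y , A⊂Y , Y⊂⊤ , ⊥≢A , ⊥≢Y , A≢Y) =
    inj₁ (A , pivot (chain A⊂Y Y⊂⊤ ⊥≢A ⊥≢Y A≢Y) exact)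
  ... | no none =
    inj₂ (twoColorsBelowTop 3≤k exact λ (chain A⊂Y Y⊂⊤ ⊥≢A ⊥≢Y A≢Y) →
      none (_ , _ , A⊂Y , Y⊂⊤ , ⊥≢A , ⊥≢Y , A≢Y))

-- Both forms exclude rainbow copies.

pivot⇒free : {c : Coloring n k} → Pivot c A → ¬ RainbowInduced∨₂ c
pivot⇒free {n = n} {A = A} {c = c} p r = case (A ⊆? X₀)
  where
  open Pivot p
  open RainbowInduced∨₂ r

  X₁⊂⊤ = ⊈⇒⊂⊤ X₂⊈X₁
  X₂⊂⊤ = ⊈⇒⊂⊤ X₁⊈X₂

  A⊆ : A ⊈ X₀ → c X₀ ≢ c Z → A ⊆ Z
  A⊆ {Z = Z} A⊈X₀ c₀≢ = decidable-stable (A ⊆? Z) λ A⊈Z →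
    c₀≢ (other-mono (A⊈X₀ ∘ proj₁) (A⊈Z ∘ proj₁))

  A⊂ : A ⊆ Y → A ⊆ Z → Y ⊈ Z → A ⊂ Y
  A⊂ A⊆Y A⊆Z Y⊈Z = ⊆∧⊉⇒⊂ A⊆Y λ Y⊆A → Y⊈Z (λ x∈Y → A⊆Z (Y⊆A x∈Y))

  case : Dec (A ⊆ X₀) → Empty
  case (yes A⊆X₀) =
    c₁≢c₂ (above-mono (⊆-⊂-trans A⊆X₀ X₀⊂X₁ , X₁⊂⊤) (⊆-⊂-trans A⊆X₀ X₀⊂X₂ , X₂⊂⊤))
  -- Sets colored unlike `X₀` must contain `A`; being incomparable, neither `X₁` nor `X₂` equals
  -- `A`.
  case (no A⊈X₀) =
    c₁≢c₂ (above-mono (A⊂ A⊆X₁ A⊆X₂ X₁⊈X₂ , X₁⊂⊤) (A⊂ A⊆X₂ A⊆X₁ X₂⊈X₁ , X₂⊂⊤))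
    where
    A⊆X₁ = A⊆ A⊈X₀ c₀≢c₁
    A⊆X₂ = A⊆ A⊈X₀ c₀≢c₂

-- Incomparability keeps `X₁` and `X₂` off `⊤`, so three sets share two colors.
twoColors⇒free : {c : Coloring n k} → ExactlyTwoColorsOn c (rightOpen ⊥ ⊤) →
  ¬ RainbowInduced∨₂ c
twoColors⇒free {c = c} (i , j , _ , colors) r =
  pigeon (color (⊂-⊆-trans X₀⊂X₁ ⊆⊤)) (color (⊈⇒⊂⊤ X₂⊈X₁)) (color (⊈⇒⊂⊤ X₁⊈X₂))
  where
  open RainbowInduced∨₂ r

  color : Z ⊂ ⊤ → c Z ≡ i ⊎ c Z ≡ j
  color Z⊂⊤ = Equivalence.to (colors _) (_ , (⊥⊆ , Z⊂⊤) , refl)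

  pigeon : c X₀ ≡ i ⊎ c X₀ ≡ j → c X₁ ≡ i ⊎ c X₁ ≡ j → c X₂ ≡ i ⊎ c X₂ ≡ j → Empty
  pigeon (inj₁ p) (inj₁ q) _        = c₀≢c₁ (trans p (sym q))
  pigeon (inj₂ p) (inj₂ q) _        = c₀≢c₁ (trans p (sym q))
  pigeon (inj₁ p) (inj₂ _) (inj₁ q) = c₀≢c₂ (trans p (sym q))
  pigeon (inj₁ _) (inj₂ p) (inj₂ q) = c₁≢c₂ (trans p (sym q))
  pigeon (inj₂ _) (inj₁ p) (inj₁ q) = c₁≢c₂ (trans p (sym q))
  pigeon (inj₂ p) (inj₁ _) (inj₂ q) = c₀≢c₂ (trans p (sym q))

theorem2p3 : ∀ (k n : ℕ) → 3 ≤ k → 2 ≤ n → (c : Coloring n k) → Exact c →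
    (¬ RainbowInduced∨₂ c) ⇔ (PivotColoring c ⊎ TwoColorsBelowTop c)
theorem2p3 k n 3≤k _ c exact = mk⇔
  (λ free → RainbowFree.structure free 3≤k exact)
  [ (λ (A , p) → pivot⇒free p) , (λ (two , _) → twoColors⇒free two) ]′
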